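{- Let $M$ be an acyclic oriented matroid on a finite set $E$, and let $t(M)$ be the maximal $k$ such that there exists a transitive coloring of $M$ using exactly $k$ colors. Then $t(M)=\operatorname{rank}(M)$.
   Context: An oriented matroid is acyclic if it has no positive circuit (no signed circuit $X=(X^+,X^-)$ with $X^-=\varnothing$). A transitive coloring of an oriented matroid $M$ on a finite set $E$ is a function $\varepsilon$ from $E$ to a set of colors such that for every signed circuit $X=(X^+,X^-)$ of $M$, $\{\varepsilon(e): e\in X^+\}\cap\{\varepsilon(e): e\in X^-\}\neq\varnothing$. It uses exactly $k$ colors if $|\varepsilon(E)|=k$. (If $E=\varnothing$, then $t(M)=0$.) -}

module Defs where

open import Data.Empty.Irrelevant using (⊥-elim)
open import Data.Fin using (Fin)
open import Data.Fin.Subset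
open import Data.Fin.Subset.Properties
open import Data.Nat using (ℕ; zero; suc; _≤_; z≤n)
open import Data.Nat.Properties using (m≤n⇒m<n∨m≡n; ≤-pred; _≟_)
open import Data.Product using (∃; ∃-syntax; _×_; _,_; proj₁; proj₂)
open import Data.Sum using (_⊎_; inj₁; inj₂)
open import Function.Definitions using (Injective)
open import Level using (Level)
open import Relation.Binary.PropositionalEquality
open import Relation.Nullary using (¬_; Dec; yes; no; contradiction)
open import Relation.Nullary.Decidable using (map′; ¬?; _×-dec_)
open import Relation.Unary using (Decidable)

private
  variable
    ℓ : Level
    n : ℕ

-- `disjoint` is irrelevant so that _≡_ on signed sets is equality of the
-- positive and of the negative parts.
record SignedSubset (n : ℕ) : Set where
  constructor signed
  field
    pos neg   : Subset n
    .disjoint : Empty (pos ∩ neg)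

open SignedSubset public using (pos; neg)

supp : SignedSubset n → Subset n
supp X = pos X ∪ neg X

infix 8 ⁻_
⁻_ : SignedSubset n → SignedSubset n
⁻ signed p m d = signed m p (subst Empty (∩-comm p m) d)

-- The circuit axioms, with weak elimination. The collection of circuits is a
-- set of signed subsets of a finite set, so classically `circuit?` is no restriction.
record OrientedMatroid (n : ℕ) : Set₁ where
  field
    Circuit      : SignedSubset n → Set
    circuit?     : Decidable Circuit
    nonempty     : ∀ X → Circuit X → Nonempty (supp X)
    symmetric    : ∀ X → Circuit X → Circuit (⁻ X)
    incomparable : ∀ X Y → Circuit X → Circuit Y → supp X ⊆ supp Y →
                     X ≡ Y ⊎ X ≡ ⁻ Y
    elimination  : ∀ X Y → Circuit X → Circuit Y → X ≢ ⁻ Y →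
                     ∀ e → e ∈ pos X → e ∈ neg Y →
                     ∃[ Z ] Circuit Z
                          × pos Z ⊆ (pos X ∪ pos Y) - e
                          × neg Z ⊆ (neg X ∪ neg Y) - e

open OrientedMatroid public using (Circuit; circuit?)

Acyclic : OrientedMatroid n → Set
Acyclic M = ¬ (∃[ X ] Circuit M X × Empty (neg X))

IsMaximum : (ℕ → Set ℓ) → ℕ → Set ℓ
IsMaximum P k = P k × (∀ j → P j → j ≤ k)

Independent : OrientedMatroid n → Subset n → Set
Independent M S = ¬ (∃[ X ] Circuit M X × supp X ⊆ S)

HasIndependentOfSize : OrientedMatroid n → ℕ → Set
HasIndependentOfSize M k = ∃[ S ] Independent M S × ∣ S ∣ ≡ k

private
  anySigned? : {P : SignedSubset n → Set} → Decidable P → Dec (∃ P)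
  anySigned? {P = P} P? =
    map′ (λ (p , m , d , x) → signed p m d , x)
         (λ { (signed p m d , x) → p , m , recover p m d , x })
         (anySubset? λ p → anySubset? λ m → with-disjoint p m)
    where
    recover : ∀ p m → .(Empty (p ∩ m)) → Empty (p ∩ m)
    recover p m d ne = ⊥-elim (d ne)

    with-disjoint : ∀ p m → Dec (∃ λ (d : Empty (p ∩ m)) → P (signed p m d))
    with-disjoint p m with nonempty? (p ∩ m)
    ... | yes ne = no λ (d , _) → d ne
    ... | no d   = map′ (d ,_) proj₂ (P? (signed p m d))

independent? : (M : OrientedMatroid n) → Decidable (Independent M)
independent? M S =
  ¬? (anySigned? λ X → circuit? M X ×-dec (supp X ⊆? S))

hasIndependentOfSize? : (M : OrientedMatroid n) → Decidable (HasIndependentOfSize M)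
hasIndependentOfSize? M k =
  anySubset? λ S → independent? M S ×-dec (∣ S ∣ ≟ k)

private
  maximum : {P : ℕ → Set ℓ} → Decidable P → P 0 →
            ∀ b → (∀ j → P j → j ≤ b) → ∃ (IsMaximum P)
  maximum P? p₀ zero    bound = 0 , p₀ , bound
  maximum {P = P} P? p₀ (suc b) bound with P? (suc b)
  ... | yes p = suc b , p , bound
  ... | no ¬p = maximum P? p₀ b bound′
    where
    bound′ : ∀ j → P j → j ≤ b
    bound′ j p with m≤n⇒m<n∨m≡n (bound j p)
    ... | inj₁ j<1+b = ≤-pred j<1+b
    ... | inj₂ refl  = contradiction p ¬p

  rank-exists : (M : OrientedMatroid n) → ∃ (IsMaximum (HasIndependentOfSize M))
  rank-exists {n} M = maximum (hasIndependentOfSize? M)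
    (⊥ , ⊥-independent , ∣⊥∣≡0 n) n (λ { _ (S , _ , refl) → ∣p∣≤n S })
    where
    ⊥-independent : Independent M ⊥
    ⊥-independent (X , cX , X⊆⊥) =
      let _ , e∈X = OrientedMatroid.nonempty M X cX in ∉⊥ (X⊆⊥ e∈X)

rank : OrientedMatroid n → ℕ
rank M = proj₁ (rank-exists M)

rank-isMaximum : (M : OrientedMatroid n) →
                 IsMaximum (HasIndependentOfSize M) (rank M)
rank-isMaximum M = proj₂ (rank-exists M)

TransitiveColoring : {Color : Set} → OrientedMatroid n → (Fin n → Color) → Set
TransitiveColoring M ε =
  ∀ X → Circuit M X → ∃[ e ] ∃[ f ] e ∈ pos X × f ∈ neg X × ε e ≡ ε f

-- ∣ε(E)∣ = k, witnessed by an enumeration c of the image without repetition.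
UsesExactly : {Color : Set} → ℕ → (Fin n → Color) → Set
UsesExactly {Color = Color} k ε =
  ∃ λ (c : Fin k → Color) → Injective _≡_ _≡_ c
    × (∀ i → ∃[ e ] ε e ≡ c i)
    × (∀ e → ∃[ i ] ε e ≡ c i)

HasTransitiveColoring : OrientedMatroid n → ℕ → Set₁
HasTransitiveColoring {n} M k =
  ∃ λ (Color : Set) → ∃ λ (ε : Fin n → Color) →
    TransitiveColoring M ε × UsesExactly k ε

-- The relation t(M) = k.
t[_]≡_ : OrientedMatroid n → ℕ → Set₁
t[ M ]≡ k = IsMaximum (HasTransitiveColoring M) k

{-# OPTIONS --safe #-}

-- The representatives of the color classes of a transitive coloring form an
-- independent set, so t(M) ≤ rank M. For the converse, suppose M is acyclic and
-- has no two parallel elements. Then some e is extreme: no circuit has {e} as its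
-- negative part. Hence M / e is acyclic, of rank one less, and a transitive
-- coloring of M / e extends to one of M by giving e a color of its own. If e and
-- f are parallel, a transitive coloring of M \ f extends by giving f the color
-- of e.

module Submission where

open import Defs
open import Data.Empty.Irrelevant using (⊥-elim)
open import Data.Fin using (Fin; zero; suc; toℕ; fromℕ<)
open import Data.Fin.Properties using (suc-injective; toℕ-injective; toℕ<n; toℕ-fromℕ<)
  renaming (_≟_ to _≟ᶠ_)
open import Data.Fin.Subset
open import Data.Fin.Subset.Induction using (Acc; acc; ⊂-wellFounded)
open import Data.Fin.Subset.Properties
open import Data.Nat using (ℕ; zero; suc; _≤_; _<_; z≤n; s≤s)
open import Data.Nat.Properties
  using (≤-refl; ≤-reflexive; ≤-trans; ≤-antisym; m<n⇒m<1+n; m≤n⇒m≤1+n; n<1+n; m<1+n⇒m<n∨m≡n)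
open import Data.Product using (∃; ∃-syntax; _×_; _,_; proj₁; proj₂)
open import Data.Sum using (_⊎_; inj₁; inj₂; [_,_]′)
  renaming (map to map-⊎)
open import Data.Vec using (_∷_; here; there)
open import Data.Vec.Functional using (updateAt)
open import Data.Vec.Functional.Properties using (updateAt-updates; updateAt-minimal)
open import Function using (_∘_; const; id)
open import Function.Definitions using (Injective)
open import Relation.Binary.PropositionalEquality
open import Relation.Nullary using (¬_; Dec; yes; no; contradiction)
open import Relation.Nullary.Decidable using (map′; _×-dec_)
open import Relation.Unary using (Decidable)

private
  variable
    n : ℕ
    p q r s : Subset n
    x y : Fin n

-- Subsets of a finite set.

x∈p─q⇒x∉q : ∀ (p q : Subset n) → x ∈ p ─ q → x ∉ q
x∈p─q⇒x∉q (_ ∷ p) (outside ∷ q) (there x∈) (there x∈q) = x∈p─q⇒x∉q p q x∈ x∈q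
x∈p─q⇒x∉q (_ ∷ p) (inside  ∷ q) (there x∈) (there x∈q) = x∈p─q⇒x∉q p q x∈ x∈q

x∈p-y⁻ : x ∈ p - y → x ∈ p × x ≢ y
x∈p-y⁻ {p = p} {y = y} x∈ =
  p─q⊆p p ⁅ y ⁆ x∈ , λ { refl → x∈p─q⇒x∉q p ⁅ y ⁆ x∈ (x∈⁅x⁆ y) }

x∈p∧y∉p⇒x≢y : x ∈ p → y ∉ p → x ≢ y
x∈p∧y∉p⇒x≢y x∈p y∉p refl = y∉p x∈p

x∈p∪q∧x∉q⇒x∈p : x ∈ p ∪ q → x ∉ q → x ∈ p
x∈p∪q∧x∉q⇒x∈p {p = p} {q = q} x∈ x∉q =
  [ id , (λ x∈q → contradiction x∈q x∉q) ]′ (x∈p∪q⁻ p q x∈)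

x∈p∪q∧x∉p⇒x∈q : x ∈ p ∪ q → x ∉ p → x ∈ q
x∈p∪q∧x∉p⇒x∈q {p = p} {q = q} x∈ x∉p =
  [ (λ x∈p → contradiction x∈p x∉p) , id ]′ (x∈p∪q⁻ p q x∈)

∪-lub : p ⊆ r → q ⊆ r → p ∪ q ⊆ r
∪-lub {p = p} {q = q} p⊆r q⊆r x∈ = [ p⊆r , q⊆r ]′ (x∈p∪q⁻ p q x∈)

∪-mono-⊆ : p ⊆ r → q ⊆ s → p ∪ q ⊆ r ∪ s
∪-mono-⊆ {r = r} {s = s} p⊆r q⊆s =
  ∪-lub (p⊆p∪q s ∘ p⊆r) (q⊆p∪q r s ∘ q⊆s)

x∈p⇒⁅x⁆⊆p : x ∈ p → ⁅ x ⁆ ⊆ p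
x∈p⇒⁅x⁆⊆p {x = x} {p = p} x∈p y∈ = subst (_∈ p) (sym (x∈⁅y⁆⇒x≡y x y∈)) x∈p

x∈p∪⁅y⁆⇒x≡y : x ∈ p ∪ ⁅ y ⁆ → x ∉ p → x ≡ y
x∈p∪⁅y⁆⇒x≡y {y = y} x∈ x∉p = x∈⁅y⁆⇒x≡y y (x∈p∪q∧x∉p⇒x∈q x∈ x∉p)

delete-⊆ : ∀ (A : Subset n) f → (A - f) ∪ q ⊆ A ∪ q
delete-⊆ A f = ∪-mono-⊆ (p─q⊆p A ⁅ f ⁆) id

-- Contracting an element `e` of `G` moves it from `G` to the contracted set `K`, so the ambient
-- union stays the same. The two inclusions are used in opposite directions: this one for circuits,
-- `contract-⊇` for acyclicity and independence.
contract-⊆ : ∀ (G K : Subset n) e → G ∪ K ⊆ (G - e) ∪ (K ∪ ⁅ e ⁆)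
contract-⊆ G K e = ∪-lub G⊆ (q⊆p∪q (G - e) (K ∪ ⁅ e ⁆) ∘ p⊆p∪q ⁅ e ⁆)
  where
  G⊆ : G ⊆ (G - e) ∪ (K ∪ ⁅ e ⁆)
  G⊆ {x} x∈G with x ≟ᶠ e
  ... | yes refl = q⊆p∪q (G - e) (K ∪ ⁅ e ⁆) (q⊆p∪q K ⁅ e ⁆ (x∈⁅x⁆ e))
  ... | no x≢e   = p⊆p∪q (K ∪ ⁅ e ⁆) (x∈p∧x≢y⇒x∈p-y x∈G x≢e)

contract-⊇ : ∀ (G K : Subset n) e → e ∈ G → (G - e) ∪ (K ∪ ⁅ e ⁆) ⊆ G ∪ K
contract-⊇ G K e e∈G =
  ∪-lub (p⊆p∪q K ∘ p─q⊆p G ⁅ e ⁆)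
        (∪-lub (q⊆p∪q G K) (p⊆p∪q K ∘ x∈p⇒⁅x⁆⊆p e∈G))

⊈⇒∃ : ¬ p ⊆ q → ∃[ x ] x ∈ p × x ∉ q
⊈⇒∃ {p = p} {q = q} p⊈q with nonempty? (p ─ q)
... | yes (x , x∈) = x , p─q⊆p p q x∈ , x∈p─q⇒x∉q p q x∈
... | no empty     = ⊥-elim (p⊈q p⊆q)
  where
  p⊆q : p ⊆ q
  p⊆q {x} x∈p with x ∈? q
  ... | yes x∈q = x∈q
  ... | no x∉q  = contradiction (x , x∈p∧x∉q⇒x∈p─q x∈p x∉q) empty

∣p∣≤1+∣p-x∣ : ∀ (p : Subset n) x → ∣ p ∣ ≤ suc ∣ p - x ∣
∣p∣≤1+∣p-x∣ (inside  ∷ p) zero    = s≤s (≤-reflexive (cong ∣_∣ (sym (p─⊥≡p p))))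
∣p∣≤1+∣p-x∣ (outside ∷ p) zero    = m≤n⇒m≤1+n (≤-reflexive (cong ∣_∣ (sym (p─⊥≡p p))))
∣p∣≤1+∣p-x∣ (inside  ∷ p) (suc x) = s≤s (∣p∣≤1+∣p-x∣ p x)
∣p∣≤1+∣p-x∣ (outside ∷ p) (suc x) = ∣p∣≤1+∣p-x∣ p x

x∉p⇒∣p∣<∣p∪⁅x⁆∣ : x ∉ p → ∣ p ∣ < ∣ p ∪ ⁅ x ⁆ ∣
x∉p⇒∣p∣<∣p∪⁅x⁆∣ {x = x} {p = p} x∉p =
  p⊂q⇒∣p∣<∣q∣ (p⊆p∪q ⁅ x ⁆ , x , q⊆p∪q p ⁅ x ⁆ (x∈⁅x⁆ x) , x∉p)

-- Turns distinct representatives into a `Subset`, whose size can then be compared with the rank.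
injective⇒image : ∀ k (f : Fin k → Fin n) → Injective _≡_ _≡_ f →
                  ∃[ S ] k ≤ ∣ S ∣ × (∀ {x} → x ∈ S → ∃[ i ] x ≡ f i)
injective⇒image zero    f inj = ⊥ , z≤n , λ x∈⊥ → contradiction x∈⊥ ∉⊥
injective⇒image (suc k) f inj =
  let S , k≤∣S∣ , S⊆ = injective⇒image k (f ∘ suc) (suc-injective ∘ inj)
      f0∉S : f zero ∉ S
      f0∉S f0∈S = let _ , eq = S⊆ f0∈S in contradiction (inj eq) λ ()
  in S ∪ ⁅ f zero ⁆
   , ≤-trans (s≤s k≤∣S∣) (x∉p⇒∣p∣<∣p∪⁅x⁆∣ f0∉S)
   , λ x∈ → [ (λ x∈S → let i , eq = S⊆ x∈S in suc i , eq)
            , (λ x∈f0 → zero , x∈⁅y⁆⇒x≡y (f zero) x∈f0) ]′ (x∈p∪q⁻ S ⁅ f zero ⁆ x∈)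

-- Signed subsets.

pos-neg-disjoint : ∀ (X : SignedSubset n) → x ∈ pos X → x ∉ neg X
pos-neg-disjoint (signed _ _ d) x∈pos x∈neg = ⊥-elim (d (_ , x∈p∩q⁺ (x∈pos , x∈neg)))

pos⊆supp : ∀ (X : SignedSubset n) → pos X ⊆ supp X
pos⊆supp X = p⊆p∪q (neg X)

neg⊆supp : ∀ (X : SignedSubset n) → neg X ⊆ supp X
neg⊆supp X = q⊆p∪q (pos X) (neg X)

supp-⁻ : ∀ (X : SignedSubset n) → supp (⁻ X) ⊆ supp X
supp-⁻ X = ∪-lub (neg⊆supp X) (pos⊆supp X)

-- Case distinctions on whether a circuit of a given kind exists rest on this finite search.
anySigned? : {P : SignedSubset n → Set} → Decidable P → Dec (∃ P)
anySigned? {P = P} P? =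
  map′ (λ (p , m , d , x) → signed p m d , x)
       (λ (X , x) → pos X , neg X , (λ (_ , x∈) → disjoint-parts X x∈) , x)
       (anySubset? λ p → anySubset? λ m → parts? p m)
  where
  disjoint-parts : ∀ X → x ∉ pos X ∩ neg X
  disjoint-parts X x∈ =
    let x∈pos , x∈neg = x∈p∩q⁻ (pos X) (neg X) x∈ in pos-neg-disjoint X x∈pos x∈neg

  parts? : ∀ p m → Dec (∃ λ (d : Empty (p ∩ m)) → P (signed p m d))
  parts? p m with nonempty? (p ∩ m)
  ... | yes ne = no λ (d , _) → d ne
  ... | no d   = map′ (d ,_) proj₂ (P? (signed p m d))

-- Minors: acyclicity, colorings and parallel elements.

module _ (M : OrientedMatroid n) where

  open OrientedMatroid M using (symmetric; elimination)

  -- The minor M|(G ∪ K) / K is handled through the circuits X of M with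
  -- supp X ⊆ G ∪ K, of which only the part outside K counts.
  AcyclicOver : Subset n → Subset n → Set
  AcyclicOver H K = ∀ X → Circuit M X → supp X ⊆ H → ¬ neg X ⊆ K

  -- The condition ranges over the traces outside `K` of all circuits in `H`, and not only over the
  -- minimal traces, which are the circuits of the minor.
  TransitiveOver : Subset n → Subset n → (Fin n → ℕ) → Set
  TransitiveOver H K ε =
    ∀ X → Circuit M X → supp X ⊆ H →
    ∃[ e ] ∃[ f ] (e ∈ pos X × e ∉ K) × (f ∈ neg X × f ∉ K) × ε e ≡ ε f

  -- The colors used on `G` are exactly the numbers below `k`, so `k` itself is a fresh color.
  -- Values of `ε` outside `G` are arbitrary.
  HasColoringOver : Subset n → Subset n → ℕ → Set
  HasColoringOver G K k =
    ∃[ ε ] TransitiveOver (G ∪ K) K ε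
         × (∀ {x} → x ∈ G → ε x < k)
         × (∀ {i} → i < k → ∃[ x ] x ∈ G × ε x ≡ i)

  -- Up to elements of `K`, the circuit has positive part `e` and negative part `f`. The inclusions
  -- only say "at most"; acyclicity supplies the memberships through `sole-pos` and `sole-neg`.
  Parallel : Subset n → Subset n → Fin n → Fin n → Set
  Parallel G K e f =
    ∃[ X ] Circuit M X × supp X ⊆ G ∪ K × pos X ⊆ K ∪ ⁅ e ⁆ × neg X ⊆ K ∪ ⁅ f ⁆

  private
    variable
      G H H′ K K′ S : Subset n
      e f : Fin n

  AcyclicOver-antimono : H′ ⊆ H → K′ ⊆ K → AcyclicOver H K → AcyclicOver H′ K′
  AcyclicOver-antimono H′⊆H K′⊆K acyclic X cX X⊆H′ neg⊆K′ =
    acyclic X cX (H′⊆H ∘ X⊆H′) (K′⊆K ∘ neg⊆K′)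

  -- Acyclicity is mostly used in this form. It also excludes circuits inside `K`, so `K` is
  -- independent whenever `K ⊆ H`.
  neg-outside : AcyclicOver H K → ∀ X → Circuit M X → supp X ⊆ H →
                ∃[ x ] x ∈ neg X × x ∉ K
  neg-outside acyclic X cX X⊆H = ⊈⇒∃ (acyclic X cX X⊆H)

  pos-outside : AcyclicOver H K → ∀ X → Circuit M X → supp X ⊆ H →
                ∃[ x ] x ∈ pos X × x ∉ K
  pos-outside acyclic X cX X⊆H =
    neg-outside acyclic (⁻ X) (symmetric X cX) (X⊆H ∘ supp-⁻ X)

  sole-neg : AcyclicOver H K → ∀ X → Circuit M X → supp X ⊆ H → neg X ⊆ K ∪ ⁅ e ⁆ →
             e ∈ neg X × e ∉ K
  sole-neg {K = K} acyclic X cX X⊆H neg⊆ =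
    let x , x∈neg , x∉K = neg-outside acyclic X cX X⊆H
    in subst (λ z → z ∈ neg X × z ∉ K) (x∈p∪⁅y⁆⇒x≡y (neg⊆ x∈neg) x∉K) (x∈neg , x∉K)

  sole-pos : AcyclicOver H K → ∀ X → Circuit M X → supp X ⊆ H → pos X ⊆ K ∪ ⁅ e ⁆ →
             e ∈ pos X × e ∉ K
  sole-pos acyclic X cX X⊆H = sole-neg acyclic (⁻ X) (symmetric X cX) (X⊆H ∘ supp-⁻ X)

  -- Elimination of an element between two circuits.

  eliminate : ∀ X Y → Circuit M X → Circuit M Y → X ≢ ⁻ Y →
              ∀ e → e ∈ pos X → e ∈ neg Y →
              ∃[ Z ] Circuit M Z
                   × (∀ {x} → x ∈ pos Z → (x ∈ pos X ⊎ x ∈ pos Y) × x ≢ e)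
                   × (∀ {x} → x ∈ neg Z → (x ∈ neg X ⊎ x ∈ neg Y) × x ≢ e)
  eliminate X Y cX cY X≢⁻Y e e∈X e∈Y =
    let Z , cZ , posZ , negZ = elimination X Y cX cY X≢⁻Y e e∈X e∈Y
    in Z , cZ
     , (λ x∈ → let x∈∪ , x≢e = x∈p-y⁻ (posZ x∈) in x∈p∪q⁻ (pos X) (pos Y) x∈∪ , x≢e)
     , (λ x∈ → let x∈∪ , x≢e = x∈p-y⁻ (negZ x∈) in x∈p∪q⁻ (neg X) (neg Y) x∈∪ , x≢e)

  supp⊆-delete : ∀ X A → supp X ⊆ A ∪ K → ¬ (f ∈ supp X × f ∉ K) → supp X ⊆ (A - f) ∪ K
  supp⊆-delete {K = K} {f = f} X A X⊆ f∉ {x} x∈X with x ∈? K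
  ... | yes x∈K = q⊆p∪q (A - f) K x∈K
  ... | no x∉K  = p⊆p∪q K (x∈p∧x≢y⇒x∈p-y (x∈p∪q∧x∉q⇒x∈p (X⊆ x∈X) x∉K)
                                         λ { refl → f∉ (x∈X , x∉K) })

  -- The new circuit avoids `f`, so it lives over `A - f`, where what is known about the deletion of
  -- `f` applies.
  eliminate-within :
    ∀ X Y A → Circuit M X → Circuit M Y → supp X ⊆ A ∪ K → supp Y ⊆ A ∪ K → X ≢ ⁻ Y →
    ∀ f → f ∈ pos X → f ∈ neg Y →
    ∃[ Z ] Circuit M Z × supp Z ⊆ (A - f) ∪ K
         × (∀ {x} → x ∈ pos Z → (x ∈ pos X ⊎ x ∈ pos Y) × x ≢ f)
         × (∀ {x} → x ∈ neg Z → (x ∈ neg X ⊎ x ∈ neg Y) × x ≢ f)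
  eliminate-within {K = K} X Y A cX cY X⊆ Y⊆ X≢⁻Y f f∈X f∈Y =
    let Z , cZ , posZ , negZ = eliminate X Y cX cY X≢⁻Y f f∈X f∈Y
        Z⊆ : supp Z ⊆ A ∪ K
        Z⊆ = ∪-lub (λ x∈ → [ X⊆ ∘ pos⊆supp X , Y⊆ ∘ pos⊆supp Y ]′ (proj₁ (posZ x∈)))
                   (λ x∈ → [ X⊆ ∘ neg⊆supp X , Y⊆ ∘ neg⊆supp Y ]′ (proj₁ (negZ x∈)))
        f∉Z : f ∉ supp Z
        f∉Z f∈Z = [ (λ f∈pos → proj₂ (posZ f∈pos) refl)
                  , (λ f∈neg → proj₂ (negZ f∈neg) refl) ]′
                  (x∈p∪q⁻ (pos Z) (neg Z) f∈Z)
    in Z , cZ , supp⊆-delete Z A Z⊆ (f∉Z ∘ proj₁) , posZ , negZ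

  orient : ∀ X → Circuit M X → e ∈ supp X →
           ∃[ X′ ] Circuit M X′ × supp X′ ≡ supp X × e ∈ pos X′
  orient X cX e∈X with x∈p∪q⁻ (pos X) (neg X) e∈X
  ... | inj₁ e∈pos = X , cX , refl , e∈pos
  ... | inj₂ e∈neg = ⁻ X , symmetric X cX , ∪-comm (neg X) (pos X) , e∈neg

  -- Signs do not matter here: both circuits are oriented to have `e` positive, and one of them is
  -- then negated. The element `f` tells the two supports apart, so the circuits are not equal up to
  -- sign.
  eliminate-unsigned : ∀ X Y → Circuit M X → Circuit M Y → e ∈ supp X → e ∈ supp Y →
                       f ∈ supp X → f ∉ supp Y →
                       ∃[ Z ] Circuit M Z
                            × (∀ {x} → x ∈ supp Z → (x ∈ supp X ⊎ x ∈ supp Y) × x ≢ e)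
  eliminate-unsigned {e = e} {f = f} X Y cX cY e∈X e∈Y f∈X f∉Y =
    let X′ , cX′ , X′≡X , e∈posX′ = orient X cX e∈X
        Y′ , cY′ , Y′≡Y , e∈posY′ = orient Y cY e∈Y
        X′≢Y′ : X′ ≢ Y′
        X′≢Y′ X′≡Y′ = f∉Y (subst (f ∈_) (trans (sym X′≡X) (trans (cong supp X′≡Y′) Y′≡Y)) f∈X)
        -- `eliminate` asks for `X′ ≢ ⁻ ⁻ Y′`, which is `X′ ≢ Y′` definitionally, by eta and
        -- irrelevance of the disjointness proof.
        Z , cZ , posZ , negZ =
          eliminate X′ (⁻ Y′) cX′ (symmetric Y′ cY′) X′≢Y′ e e∈posX′ e∈posY′
        from-pos = λ {x} (x∈ : x ∈ pos Z) → let x∈∪ , x≢e = posZ x∈ in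
          map-⊎ (subst (x ∈_) X′≡X ∘ pos⊆supp X′) (subst (x ∈_) Y′≡Y ∘ neg⊆supp Y′) x∈∪ , x≢e
        from-neg = λ {x} (x∈ : x ∈ neg Z) → let x∈∪ , x≢e = negZ x∈ in
          map-⊎ (subst (x ∈_) X′≡X ∘ neg⊆supp X′) (subst (x ∈_) Y′≡Y ∘ pos⊆supp Y′) x∈∪ , x≢e
    in Z , cZ , λ x∈ → [ from-pos , from-neg ]′ (x∈p∪q⁻ (pos Z) (neg Z) x∈)

  -- Existence of extreme elements.

  circuitWithin? : ∀ H L → Dec (∃[ X ] Circuit M X × supp X ⊆ H × neg X ⊆ L)
  circuitWithin? H L =
    anySigned? λ X → circuit? M X ×-dec (supp X ⊆? H) ×-dec (neg X ⊆? L)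

  -- Induction on `A`, removing `f`; everything is meant outside `K`. An element `e` extreme in
  -- `A - f` either stays extreme in `A` or is the sole negative element of a circuit `X`, which
  -- must then contain `f` positively. If `f` is the only positive element of `X`, the two are
  -- parallel; otherwise `f` itself is extreme.
  parallel-or-extreme :
    ∀ A → Acc _⊂_ A → Nonempty A → AcyclicOver (A ∪ K) K →
    (∃[ e ] ∃[ f ] Parallel A K e f) ⊎ (∃[ e ] e ∈ A × AcyclicOver (A ∪ K) (K ∪ ⁅ e ⁆))
  parallel-or-extreme {K = K} A (acc rec) (f , f∈A) acyclic with nonempty? (A - f)
  ... | no A-f-empty = inj₂ (f , f∈A , f-extreme)
    where
    outside⇒f : x ∈ A ∪ K → x ∉ K → x ≡ f
    outside⇒f {x} x∈ x∉K with x ≟ᶠ f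
    ... | yes x≡f = x≡f
    ... | no x≢f  =
      contradiction (x , x∈p∧x≢y⇒x∈p-y (x∈p∪q∧x∉q⇒x∈p x∈ x∉K) x≢f) A-f-empty

    f-extreme : AcyclicOver (A ∪ K) (K ∪ ⁅ f ⁆)
    -- Outside `K` a circuit has a positive and a negative element, and both would have to be `f`.
    f-extreme X cX X⊆ _ =
      let x , x∈neg , x∉K = neg-outside acyclic X cX X⊆
          y , y∈pos , y∉K = pos-outside acyclic X cX X⊆
          x≡f = outside⇒f (X⊆ (neg⊆supp X x∈neg)) x∉K
          y≡f = outside⇒f (X⊆ (pos⊆supp X y∈pos)) y∉K
      in pos-neg-disjoint X y∈pos (subst (_∈ neg X) (trans x≡f (sym y≡f)) x∈neg)
  ... | yes A-f-nonempty
    with parallel-or-extreme (A - f) (rec (x∈p⇒p-x⊂p f∈A)) A-f-nonempty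
           (AcyclicOver-antimono (delete-⊆ A f) id acyclic)
  ... | inj₁ (e , g , X , cX , X⊆ , pos⊆ , neg⊆) =
    inj₁ (e , g , X , cX , delete-⊆ A f ∘ X⊆ , pos⊆ , neg⊆)
  ... | inj₂ (e , e∈A-f , extreme) with circuitWithin? (A ∪ K) (K ∪ ⁅ e ⁆)
  ... | no none = inj₂ (e , proj₁ (x∈p-y⁻ e∈A-f) , λ X cX X⊆ neg⊆ → none (X , cX , X⊆ , neg⊆))
  ... | yes (X , cX , X⊆ , negX⊆) with pos X ⊆? K ∪ ⁅ f ⁆
  ... | yes posX⊆ = inj₁ (f , e , X , cX , X⊆ , posX⊆ , negX⊆)
  ... | no posX⊈ = inj₂ (f , f∈A , f-extreme)
    where
    -- Eliminating f from X and a circuit with negative part f leaves a circuit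
    -- of A - f with negative part at most e.
    f-extreme : AcyclicOver (A ∪ K) (K ∪ ⁅ f ⁆)
    f-extreme Y cY Y⊆ negY⊆ = extreme Z cZ Z⊆ negZ⊆
      where
      f∈negY×f∉K = sole-neg acyclic Y cY Y⊆ negY⊆
      f∉K = proj₂ f∈negY×f∉K

      f∉negX : f ∉ neg X
      f∉negX f∈ = proj₂ (x∈p-y⁻ e∈A-f) (sym (x∈p∪⁅y⁆⇒x≡y (negX⊆ f∈) f∉K))

      f∈posX : f ∈ pos X
      f∈posX with f ∈? pos X
      ... | yes f∈ = f∈
      -- Otherwise `X` is a circuit over `A - f` with negative part at most `e`, against the
      -- extremeness of `e` there.
      ... | no f∉ = ⊥-elim (extreme X cX (supp⊆-delete X A X⊆ f∉suppX) negX⊆)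
        where
        f∉suppX : ¬ (f ∈ supp X × f ∉ K)
        f∉suppX (f∈ , _) = f∉negX (x∈p∪q∧x∉p⇒x∈q f∈ f∉)

      -- If `X` were `⁻ Y`, its positive part would be `neg Y`, which lies in `K ∪ ⁅ f ⁆`.
      Z-elim = eliminate-within X Y A cX cY X⊆ Y⊆ (λ { refl → posX⊈ negY⊆ })
                 f f∈posX (proj₁ f∈negY×f∉K)
      Z = proj₁ Z-elim
      cZ = proj₁ (proj₂ Z-elim)
      Z⊆ = proj₁ (proj₂ (proj₂ Z-elim))
      negZ = proj₂ (proj₂ (proj₂ (proj₂ Z-elim)))

      negZ⊆ : neg Z ⊆ K ∪ ⁅ e ⁆
      negZ⊆ {x} x∈ with negZ x∈
      ... | inj₁ x∈X , _   = negX⊆ x∈X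
      ... | inj₂ x∈Y , x≢f with x∈p∪q⁻ K ⁅ f ⁆ (negY⊆ x∈Y)
      ...   | inj₁ x∈K = p⊆p∪q ⁅ e ⁆ x∈K
      ...   | inj₂ x∈f = contradiction (x∈⁅y⁆⇒x≡y f x∈f) x≢f

  -- Basis exchange in the minor.

  -- A circuit `X` in `(S ∪ ⁅ e ⁆) ∪ K` has, by acyclicity, both signs outside `K`, hence an element
  -- `g` other than `e` there to swap for `e`. A circuit `Y` in the new set avoids `g`, so
  -- eliminating `e` between `X` and `Y` would give a circuit in `S ∪ K`. If `X` or `Y` misses `e`,
  -- it already lies in `S ∪ K`.
  exchange : ∀ G K S e → AcyclicOver (G ∪ K) K → S ⊆ G → Independent M (S ∪ K) → e ∈ G →
             ∃[ S′ ] S′ ⊆ G × Independent M (S′ ∪ K) × e ∈ S′ × ∣ S ∣ ≤ ∣ S′ ∣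
  exchange G K S e acyclic S⊆G indep e∈G with e ∈? S
  ... | yes e∈S = S , S⊆G , indep , e∈S , ≤-refl
  ... | no e∉S with anySigned? (λ X → circuit? M X ×-dec (supp X ⊆? (S ∪ ⁅ e ⁆) ∪ K))
  ...   | no indep′ = S ∪ ⁅ e ⁆ , ∪-lub S⊆G (x∈p⇒⁅x⁆⊆p e∈G) , indep′
                    , q⊆p∪q S ⁅ e ⁆ (x∈⁅x⁆ e) , ∣p∣≤∣p∪q∣ S ⁅ e ⁆
  ...   | yes (X , cX , X⊆) = S′ , S′⊆G , indep′ , q⊆p∪q (S - g) ⁅ e ⁆ (x∈⁅x⁆ e) , size
    where
    X⊆G∪K : supp X ⊆ G ∪ K
    X⊆G∪K = ∪-mono-⊆ (∪-lub S⊆G (x∈p⇒⁅x⁆⊆p e∈G)) id ∘ X⊆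

    leaving : ∃[ g ] g ∈ supp X × g ∉ K × g ≢ e
    leaving with neg-outside acyclic X cX X⊆G∪K | pos-outside acyclic X cX X⊆G∪K
    ... | x , x∈neg , x∉K | y , y∈pos , y∉K with x ≟ᶠ e
    ...   | no x≢e   = x , neg⊆supp X x∈neg , x∉K , x≢e
    ...   | yes refl = y , pos⊆supp X y∈pos , y∉K , λ { refl → pos-neg-disjoint X y∈pos x∈neg }

    g = proj₁ leaving
    g∈X = proj₁ (proj₂ leaving)
    g∉K = proj₁ (proj₂ (proj₂ leaving))
    g≢e = proj₂ (proj₂ (proj₂ leaving))

    S′ = (S - g) ∪ ⁅ e ⁆

    S′⊆G : S′ ⊆ G
    S′⊆G = ∪-lub (S⊆G ∘ p─q⊆p S ⁅ g ⁆) (x∈p⇒⁅x⁆⊆p e∈G)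

    size : ∣ S ∣ ≤ ∣ S′ ∣
    size = ≤-trans (∣p∣≤1+∣p-x∣ S g) (x∉p⇒∣p∣<∣p∪⁅x⁆∣ (e∉S ∘ proj₁ ∘ x∈p-y⁻))

    drop-e : x ∈ (S ∪ ⁅ e ⁆) ∪ K → x ≢ e → x ∈ S ∪ K
    drop-e {x} x∈ x≢e with x∈p∪q⁻ (S ∪ ⁅ e ⁆) K x∈
    ... | inj₁ x∈S∪e = p⊆p∪q K (x∈p∪q∧x∉q⇒x∈p x∈S∪e (x≢y⇒x∉⁅y⁆ x≢e))
    ... | inj₂ x∈K   = q⊆p∪q S K x∈K

    S′∪K⊆ : S′ ∪ K ⊆ (S ∪ ⁅ e ⁆) ∪ K
    S′∪K⊆ = ∪-mono-⊆ (∪-mono-⊆ (p─q⊆p S ⁅ g ⁆) id) id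

    within-S∪K : ∀ X → supp X ⊆ (S ∪ ⁅ e ⁆) ∪ K → e ∉ supp X → supp X ⊆ S ∪ K
    within-S∪K X X⊆ e∉X x∈ = drop-e (X⊆ x∈) λ { refl → e∉X x∈ }

    indep′ : Independent M (S′ ∪ K)
    indep′ (Y , cY , Y⊆) with e ∈? supp X | e ∈? supp Y
    ... | no e∉X  | _       = indep (X , cX , within-S∪K X X⊆ e∉X)
    ... | yes _   | no e∉Y  = indep (Y , cY , within-S∪K Y (S′∪K⊆ ∘ Y⊆) e∉Y)
    ... | yes e∈X | yes e∈Y =
      let Z , cZ , suppZ = eliminate-unsigned X Y cX cY e∈X e∈Y g∈X g∉Y
      in indep (Z , cZ , λ x∈ → let x∈X∪Y , x≢e = suppZ x∈ in
                                drop-e ([ X⊆ , S′∪K⊆ ∘ Y⊆ ]′ x∈X∪Y) x≢e)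
      where
      g∉Y : g ∉ supp Y
      g∉Y g∈Y = proj₂ (x∈p-y⁻ (x∈p∪q∧x∉q⇒x∈p (x∈p∪q∧x∉q⇒x∈p (Y⊆ g∈Y) g∉K)
                                             (x≢y⇒x∉⁅y⁆ g≢e))) refl

  -- Extending colorings from a deletion or a contraction.

  -- The element `f` receives the color of `e`. If a circuit `X` has `f` positive and `e` negative,
  -- these two agree. Otherwise eliminating `f` between `X` and the parallel circuit puts `e` in the
  -- place of `f`, and the pair found over `G - f` is carried back. Negation handles `f` negative.
  extend-coloring-parallel :
    ∀ G K k e f → AcyclicOver (G ∪ K) K → Parallel G K e f →
    HasColoringOver (G - f) K k → HasColoringOver G K k
  extend-coloring-parallel G K k e f acyclic (Y , cY , Y⊆ , posY⊆ , negY⊆)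
    (ε , transitive , bounded , onto) = ε′ , transitive′ , bounded′ , onto′
    where
    e∈posY×e∉K = sole-pos acyclic Y cY Y⊆ posY⊆
    f∈negY×f∉K = sole-neg acyclic Y cY Y⊆ negY⊆

    e∈posY = proj₁ e∈posY×e∉K
    e∉K    = proj₂ e∈posY×e∉K
    f∈negY = proj₁ f∈negY×f∉K
    f∉K    = proj₂ f∈negY×f∉K

    e≢f : e ≢ f
    e≢f refl = pos-neg-disjoint Y e∈posY f∈negY

    ε′ = updateAt ε f (const (ε e))

    ε′-f : ε′ f ≡ ε e
    ε′-f = updateAt-updates f ε

    ε′-≢f : x ≢ f → ε′ x ≡ ε x
    ε′-≢f {x} = updateAt-minimal x f ε

    Conclusion : SignedSubset n → Set
    Conclusion X =
      ∃[ a ] ∃[ b ] (a ∈ pos X × a ∉ K) × (b ∈ neg X × b ∉ K) × ε′ a ≡ ε′ b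

    f∈pos-case : ∀ X → Circuit M X → supp X ⊆ G ∪ K → f ∈ pos X → Conclusion X
    f∈pos-case X cX X⊆ f∈posX with e ∈? neg X
    ... | yes e∈negX =
      f , e , (f∈posX , f∉K) , (e∈negX , e∉K) , trans ε′-f (sym (ε′-≢f e≢f))
    ... | no e∉negX = replace-e (transitive Z cZ Z⊆)
      where
      Z-elim = eliminate-within X Y G cX cY X⊆ Y⊆ (λ { refl → e∉negX e∈posY })
                 f f∈posX f∈negY
      Z = proj₁ Z-elim
      cZ = proj₁ (proj₂ Z-elim)
      Z⊆ = proj₁ (proj₂ (proj₂ Z-elim))
      posZ = proj₁ (proj₂ (proj₂ (proj₂ Z-elim)))
      negZ = proj₂ (proj₂ (proj₂ (proj₂ Z-elim)))

      negZ⇒negX : x ∈ neg Z → x ∉ K → x ∈ neg X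
      negZ⇒negX x∈ x∉K with negZ x∈
      ... | inj₁ x∈X , _   = x∈X
      -- Outside `K`, `neg Y` contributes only `f`, which has been eliminated.
      ... | inj₂ x∈Y , x≢f = contradiction (x∈p∪⁅y⁆⇒x≡y (negY⊆ x∈Y) x∉K) x≢f

      replace-e : ∃[ a ] ∃[ b ] (a ∈ pos Z × a ∉ K) × (b ∈ neg Z × b ∉ K) × ε a ≡ ε b →
                  Conclusion X
      replace-e (a , b , (a∈ , a∉K) , (b∈ , b∉K) , εa≡εb) with posZ a∈
      ... | inj₁ a∈X , a≢f =
        a , b , (a∈X , a∉K) , (negZ⇒negX b∈ b∉K , b∉K)
          , trans (ε′-≢f a≢f) (trans εa≡εb (sym (ε′-≢f (proj₂ (negZ b∈)))))
      -- Here `a` is `e`, the only element of `pos Y` outside `K`; `f` replaces it, having the same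
      -- color.
      ... | inj₂ a∈Y , _ =
        f , b , (f∈posX , f∉K) , (negZ⇒negX b∈ b∉K , b∉K)
          , trans ε′-f (trans (sym (cong ε (x∈p∪⁅y⁆⇒x≡y (posY⊆ a∈Y) a∉K)))
              (trans εa≡εb (sym (ε′-≢f (proj₂ (negZ b∈))))))

    transitive′ : TransitiveOver (G ∪ K) K ε′
    transitive′ X cX X⊆ with f ∈? pos X | f ∈? neg X
    ... | yes f∈pos | _ = f∈pos-case X cX X⊆ f∈pos
    ... | no _ | yes f∈neg =
      let a , b , a∈ , b∈ , eq =
            f∈pos-case (⁻ X) (symmetric X cX) (X⊆ ∘ supp-⁻ X) f∈neg
      in b , a , b∈ , a∈ , sym eq
    ... | no f∉pos | no f∉neg =
      let a , b , a∈ , b∈ , eq =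
            transitive X cX (supp⊆-delete X G X⊆ λ (f∈ , _) →
              f∉neg (x∈p∪q∧x∉p⇒x∈q f∈ f∉pos))
      in a , b , a∈ , b∈
       , trans (ε′-≢f (x∈p∧y∉p⇒x≢y (proj₁ a∈) f∉pos))
           (trans eq (sym (ε′-≢f (x∈p∧y∉p⇒x≢y (proj₁ b∈) f∉neg))))

    bounded′ : x ∈ G → ε′ x < k
    bounded′ {x} x∈G with x ≟ᶠ f
    ... | no x≢f   = subst (_< k) (sym (ε′-≢f x≢f)) (bounded (x∈p∧x≢y⇒x∈p-y x∈G x≢f))
    ... | yes refl = subst (_< k) (sym ε′-f)
      (bounded (x∈p∧x≢y⇒x∈p-y (x∈p∪q∧x∉q⇒x∈p (Y⊆ (pos⊆supp Y e∈posY)) e∉K) e≢f))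

    onto′ : ∀ {i} → i < k → ∃[ x ] x ∈ G × ε′ x ≡ i
    onto′ i<k =
      let x , x∈ , eq = onto i<k
          x∈G , x≢f = x∈p-y⁻ x∈
      in x , x∈G , trans (ε′-≢f x≢f) eq

  -- The pair that a circuit has after contracting `e` avoids `e`, so it survives any recoloring of
  -- `e`. The old colors are below `k`, so giving `k` to `e` adds exactly one color.
  extend-coloring-extreme :
    ∀ G K k e → e ∈ G → HasColoringOver (G - e) (K ∪ ⁅ e ⁆) k → HasColoringOver G K (suc k)
  extend-coloring-extreme G K k e e∈G (ε , transitive , bounded , onto) =
    ε′ , transitive′ , bounded′ , onto′
    where
    ε′ = updateAt ε e (const k)

    ε′-e : ε′ e ≡ k
    ε′-e = updateAt-updates e ε

    ε′-≢e : x ≢ e → ε′ x ≡ ε x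
    ε′-≢e {x} = updateAt-minimal x e ε

    outside-≢e : x ∉ K ∪ ⁅ e ⁆ → x ≢ e
    outside-≢e x∉ refl = x∉ (q⊆p∪q K ⁅ e ⁆ (x∈⁅x⁆ e))

    transitive′ : TransitiveOver (G ∪ K) K ε′
    transitive′ X cX X⊆ =
      let a , b , (a∈ , a∉) , (b∈ , b∉) , eq = transitive X cX (contract-⊆ G K e ∘ X⊆)
      in a , b , (a∈ , a∉ ∘ p⊆p∪q ⁅ e ⁆) , (b∈ , b∉ ∘ p⊆p∪q ⁅ e ⁆)
       , trans (ε′-≢e (outside-≢e a∉)) (trans eq (sym (ε′-≢e (outside-≢e b∉))))

    bounded′ : x ∈ G → ε′ x < suc k
    bounded′ {x} x∈G with x ≟ᶠ e
    ... | yes refl = subst (_< suc k) (sym ε′-e) (n<1+n k)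
    ... | no x≢e   = subst (_< suc k) (sym (ε′-≢e x≢e))
                       (m<n⇒m<1+n (bounded (x∈p∧x≢y⇒x∈p-y x∈G x≢e)))

    onto′ : ∀ {i} → i < suc k → ∃[ x ] x ∈ G × ε′ x ≡ i
    onto′ i<1+k with m<1+n⇒m<n∨m≡n i<1+k
    ... | inj₂ refl = e , e∈G , ε′-e
    ... | inj₁ i<k  =
      let x , x∈ , eq = onto i<k
          x∈G , x≢e = x∈p-y⁻ x∈
      in x , x∈G , trans (ε′-≢e x≢e) eq

  -- The induction on deletions and contractions.

  -- Instead of the rank of the minor, the induction carries a set `S` independent in it, as a lower
  -- bound for the number of colors. Exchange first brings `e` into `S`. Deleting a parallel `f`
  -- then leaves `S` intact, while contracting an extreme `e` costs `S` one element and gains one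
  -- color.
  coloring : ∀ G K S → Acc _⊂_ G → AcyclicOver (G ∪ K) K →
             S ⊆ G → Independent M (S ∪ K) → ∃[ k ] ∣ S ∣ ≤ k × HasColoringOver G K k
  coloring G K S (acc rec) acyclic S⊆G indep with nonempty? G
  -- With `G` empty, acyclicity leaves no circuit over `K`. The constant `0` is a default value that
  -- colors no element of `G`.
  ... | no G-empty = 0 , ≤-reflexive ∣S∣≡0 , const 0 , transitive , bounded , λ ()
    where
    ∣S∣≡0 : ∣ S ∣ ≡ 0
    ∣S∣≡0 = trans (cong ∣_∣ (Empty-unique λ (x , x∈S) → G-empty (x , S⊆G x∈S))) (∣⊥∣≡0 n)

    transitive : TransitiveOver (G ∪ K) K (const 0)
    transitive X cX X⊆ =
      let x , x∈ , x∉K = neg-outside acyclic X cX X⊆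
      in contradiction (x , x∈p∪q∧x∉q⇒x∈p (X⊆ (neg⊆supp X x∈)) x∉K) G-empty

    bounded : x ∈ G → 0 < 0
    bounded x∈G = contradiction (_ , x∈G) G-empty
  ... | yes G-nonempty with parallel-or-extreme G (acc rec) G-nonempty acyclic
  ... | inj₁ (e , f , e∥f@(Y , cY , Y⊆ , posY⊆ , negY⊆)) =
    let S′ , S′⊆G , indep′ , e∈S′ , ∣S∣≤∣S′∣ = exchange G K S e acyclic S⊆G indep e∈G
        f∉S′ : f ∉ S′
        -- With both `e` and `f` in `S′`, the parallel circuit would lie in `S′ ∪ K`.
        f∉S′ f∈S′ = indep′ (Y , cY , ∪-lub (within-S′ e∈S′ ∘ posY⊆) (within-S′ f∈S′ ∘ negY⊆))
        k , ∣S′∣≤k , colored =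
          coloring (G - f) K S′ (rec (x∈p⇒p-x⊂p f∈G))
            (AcyclicOver-antimono (delete-⊆ G f) id acyclic)
            (λ x∈ → x∈p∧x≢y⇒x∈p-y (S′⊆G x∈) λ { refl → f∉S′ x∈ }) indep′
    in k , ≤-trans ∣S∣≤∣S′∣ ∣S′∣≤k , extend-coloring-parallel G K k e f acyclic e∥f colored
    where
    e∈G : e ∈ G
    e∈G = let e∈pos , e∉K = sole-pos acyclic Y cY Y⊆ posY⊆
          in x∈p∪q∧x∉q⇒x∈p (Y⊆ (pos⊆supp Y e∈pos)) e∉K

    f∈G : f ∈ G
    f∈G = let f∈neg , f∉K = sole-neg acyclic Y cY Y⊆ negY⊆
          in x∈p∪q∧x∉q⇒x∈p (Y⊆ (neg⊆supp Y f∈neg)) f∉K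

    within-S′ : ∀ {S′ g} → g ∈ S′ → K ∪ ⁅ g ⁆ ⊆ S′ ∪ K
    within-S′ {S′} g∈S′ = ∪-lub (q⊆p∪q S′ K) (p⊆p∪q K ∘ x∈p⇒⁅x⁆⊆p g∈S′)
  ... | inj₂ (e , e∈G , extreme) =
    let S′ , S′⊆G , indep′ , e∈S′ , ∣S∣≤∣S′∣ = exchange G K S e acyclic S⊆G indep e∈G
        k , ∣S′-e∣≤k , colored =
          coloring (G - e) (K ∪ ⁅ e ⁆) (S′ - e) (rec (x∈p⇒p-x⊂p e∈G))
            (AcyclicOver-antimono (contract-⊇ G K e e∈G) id extreme)
            (λ x∈ → let x∈S′ , x≢e = x∈p-y⁻ x∈ in x∈p∧x≢y⇒x∈p-y (S′⊆G x∈S′) x≢e)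
            (λ (X , cX , X⊆) → indep′ (X , cX , contract-⊇ S′ K e e∈S′ ∘ X⊆))
    in suc k
     , ≤-trans ∣S∣≤∣S′∣ (≤-trans (∣p∣≤1+∣p-x∣ S′ e) (s≤s ∣S′-e∣≤k))
     , extend-coloring-extreme G K k e e∈G colored

  -- Comparison with the rank.

  hasColoringOver⇒hasTransitiveColoring :
    ∀ {k} → HasColoringOver ⊤ ⊥ k → HasTransitiveColoring M k
  hasColoringOver⇒hasTransitiveColoring (ε , transitive , bounded , onto) =
    ℕ , ε
    , (λ X cX → let a , b , (a∈ , _) , (b∈ , _) , eq = transitive X cX (p⊆p∪q ⊥ ∘ ⊆⊤)
                in a , b , a∈ , b∈ , eq)
    , toℕ , toℕ-injective
    , (λ i → let x , _ , eq = onto (toℕ<n i) in x , eq)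
    , λ x → fromℕ< (bounded {x} ∈⊤) , sym (toℕ-fromℕ< (bounded {x} ∈⊤))

  -- Choose one representative of each color. A circuit among them would have a positive and a
  -- negative element of equal color, hence the same representative with both signs.
  transitiveColoring⇒≤rank : ∀ k → HasTransitiveColoring M k → k ≤ rank M
  transitiveColoring⇒≤rank k (_ , ε , transitive , c , c-inj , attained , _) =
    let S , k≤∣S∣ , S⊆ = injective⇒image k rep rep-inj
        indep : Independent M S
        indep (X , cX , X⊆S) =
          let a , b , a∈ , b∈ , εa≡εb = transitive X cX
              i , a≡ = S⊆ (X⊆S (pos⊆supp X a∈))
              j , b≡ = S⊆ (X⊆S (neg⊆supp X b∈))
              ci≡cj = trans (sym (ε-rep i)) (trans (sym (cong ε a≡))
                        (trans εa≡εb (trans (cong ε b≡) (ε-rep j))))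
              a≡b = trans a≡ (trans (cong rep (c-inj ci≡cj)) (sym b≡))
          in pos-neg-disjoint X a∈ (subst (_∈ neg X) (sym a≡b) b∈)
    in ≤-trans k≤∣S∣ (proj₂ (rank-isMaximum M) ∣ S ∣ (S , indep , refl))
    where
    rep : Fin k → Fin n
    rep i = proj₁ (attained i)

    ε-rep : ∀ i → ε (rep i) ≡ c i
    ε-rep i = proj₂ (attained i)

    rep-inj : Injective _≡_ _≡_ rep
    rep-inj {i} {j} eq = c-inj (trans (sym (ε-rep i)) (trans (cong ε eq) (ε-rep j)))

theorem1p11 : ∀ (n : ℕ) (M : OrientedMatroid n) → Acyclic M → t[ M ]≡ rank M
theorem1p11 n M acyclic = subst (HasTransitiveColoring M) k≡rank colored
                        , transitiveColoring⇒≤rank M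
  where
  acyclicOver : AcyclicOver M (⊤ ∪ ⊥) ⊥
  acyclicOver X cX _ neg⊆⊥ = acyclic (X , cX , λ (_ , x∈) → ∉⊥ (neg⊆⊥ x∈))

  basis = proj₁ (rank-isMaximum M)
  S = proj₁ basis

  -- Started with nothing contracted and an independent set of maximum size, the induction yields at
  -- least `rank M` colors; the upper bound then forces equality.
  result = coloring M ⊤ ⊥ S (⊂-wellFounded ⊤) acyclicOver ⊆⊤
             (λ (X , cX , X⊆) →
                proj₁ (proj₂ basis) (X , cX , λ x∈ → x∈p∪q∧x∉q⇒x∈p (X⊆ x∈) ∉⊥))
  k = proj₁ result

  colored : HasTransitiveColoring M k
  colored = hasColoringOver⇒hasTransitiveColoring M (proj₂ (proj₂ result))

  k≡rank : k ≡ rank M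
  k≡rank = ≤-antisym (transitiveColoring⇒≤rank M k colored)
             (≤-trans (≤-reflexive (sym (proj₂ (proj₂ basis)))) (proj₁ (proj₂ result)))
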